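{- Let $\sigma$ be a permutation of length $n$, let $t\ge 0$ be an integer, and put $\sigma_t=\mathsf{Pop}^t(\sigma)$. Suppose that the element $\sigma_t(i)$ is in the interior of an increasing run of $\sigma_t$. Then $\sigma_t(i)$ is either a left-to-right maximum of $\sigma_t$, or there are at least $\left\lceil \frac{t+1}{2}\right\rceil$ elements smaller than $\sigma_t(i)$ to its left in $\sigma_t$. Similarly, $\sigma_t(i)$ is either a right-to-left minimum of $\sigma_t$, or there are at least $\left\lceil \frac{t+1}{2}\right\rceil$ elements larger than $\sigma_t(i)$ to its right in $\sigma_t$.
   Context: A permutation of length $n$ is an ordered list (one-line notation) $\sigma(1)\sigma(2)\cdots\sigma(n)$ of the elements of $\{1,\dots,n\}$, each appearing exactly once. The map $\mathsf{Pop}$ from permutations of length $n$ to permutations of length $n$ reverses, in place and simultaneously, every maximal block of consecutive entries that is decreasing; for example, $\mathsf{Pop}(471836952)=417386259$ (the blocks $71$, $83$, $952$ are reversed). $\mathsf{Pop}^t$ denotes the $t$-fold iterate, with $\mathsf{Pop}^0$ the identity map. An increasing run of a permutation is a maximal set of at least two entries occupying consecutive positions whose values increase from left to right. An element is in the interior of an increasing run if it belongs to that run but is neither the first nor the last element of that run. An entry is a left-to-right maximum if it is larger than every entry to its left, and a right-to-left minimum if it is smaller than every entry to its right. -}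

module Defs where

open import Data.Fin.Base as Fin using (Fin; toℕ)
open import Data.List.Base using (List; []; _∷_; length; lookup; filter; take; drop; reverse; concatMap; upTo; map)
open import Data.List.NonEmpty.Base using (List⁺; toList) renaming (_∷_ to _∷⁺_)
open import Data.List.Relation.Binary.Permutation.Propositional using (_↭_; ↭-refl; ↭-trans)
open import Data.List.Relation.Binary.Permutation.Propositional.Properties using (↭-reverse; ++⁺)
open import Data.Nat.Base using (ℕ; suc; _<_)
open import Data.Nat.Properties using (_<?_)
open import Data.Product.Base using (_×_; ∃₂)
open import Function.Endo.Propositional using (_^_)
open import Relation.Binary.PropositionalEquality.Core using (_≡_; refl; subst)
open import Relation.Nullary.Decidable using (yes; no)

-- One-line notation: the values are 1, …, n, so σ(i) is the entry at the
-- 0-based position i - 1 of the list.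
record Perm (n : ℕ) : Set where
  constructor mkPerm
  field
    entries       : List ℕ
    isPermutation : entries ↭ map suc (upTo n)

open Perm public

-- Prepend x, extending the first block exactly when x exceeds its head.
attach : ℕ → List (List⁺ ℕ) → List (List⁺ ℕ)
attach x []                = (x ∷⁺ []) ∷ []
attach x ((y ∷⁺ ys) ∷ bs) with y <? x
... | yes _ = (x ∷⁺ (y ∷ ys)) ∷ bs
... | no  _ = (x ∷⁺ []) ∷ (y ∷⁺ ys) ∷ bs

-- The maximal decreasing blocks, from left to right; blocks may be singletons.
decreasingBlocks : List ℕ → List (List⁺ ℕ)
decreasingBlocks []       = []
decreasingBlocks (x ∷ xs) = attach x (decreasingBlocks xs)

reverseBlocks : List (List⁺ ℕ) → List ℕ
reverseBlocks = concatMap (λ b → reverse (toList b))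

pop : List ℕ → List ℕ
pop w = reverseBlocks (decreasingBlocks w)

_ : pop (4 ∷ 7 ∷ 1 ∷ 8 ∷ 3 ∷ 6 ∷ 9 ∷ 5 ∷ 2 ∷ [])
      ≡ 4 ∷ 1 ∷ 7 ∷ 3 ∷ 8 ∷ 6 ∷ 2 ∷ 5 ∷ 9 ∷ []
_ = refl

concat-attach : ∀ x bs → concatMap toList (attach x bs) ≡ x ∷ concatMap toList bs
concat-attach x []                = refl
concat-attach x ((y ∷⁺ ys) ∷ bs) with y <? x
... | yes _ = refl
... | no  _ = refl

concat-decreasingBlocks : ∀ w → concatMap toList (decreasingBlocks w) ≡ w
concat-decreasingBlocks []       = refl
concat-decreasingBlocks (x ∷ xs)
  rewrite concat-attach x (decreasingBlocks xs) | concat-decreasingBlocks xs = refl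

reverseBlocks-↭ : ∀ bs → reverseBlocks bs ↭ concatMap toList bs
reverseBlocks-↭ []       = ↭-refl
reverseBlocks-↭ (b ∷ bs) = ++⁺ (↭-reverse (toList b)) (reverseBlocks-↭ bs)

pop-↭ : ∀ w → pop w ↭ w
pop-↭ w = subst (pop w ↭_) (concat-decreasingBlocks w) (reverseBlocks-↭ (decreasingBlocks w))

Pop : ∀ {n} → Perm n → Perm n
Pop (mkPerm w p) = mkPerm (pop w) (↭-trans (pop-↭ w) p)

Pop^ : ∀ {n} → ℕ → Perm n → Perm n
Pop^ {n} t = _^_ (Perm n) Pop t

Increasing : (w : List ℕ) (a b : Fin (length w)) → Set
Increasing w a b = ∀ i j → a Fin.≤ i → i Fin.< j → j Fin.≤ b → lookup w i < lookup w j

-- The positions a, …, b carry an increasing run: at least two entries, and no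
-- larger interval of positions is increasing.
record IncreasingRun (w : List ℕ) (a b : Fin (length w)) : Set where
  field
    twoEntries : a Fin.< b
    increasing : Increasing w a b
    maximal    : ∀ a′ b′ → a′ Fin.≤ a → b Fin.≤ b′ → Increasing w a′ b′ → a′ ≡ a × b′ ≡ b

InteriorOfIncreasingRun : (w : List ℕ) → Fin (length w) → Set
InteriorOfIncreasingRun w i = ∃₂ λ a b → IncreasingRun w a b × a Fin.< i × i Fin.< b

LeftToRightMax : (w : List ℕ) → Fin (length w) → Set
LeftToRightMax w i = ∀ j → j Fin.< i → lookup w j < lookup w i

RightToLeftMin : (w : List ℕ) → Fin (length w) → Set
RightToLeftMin w i = ∀ j → i Fin.< j → lookup w i < lookup w j

#smallerLeft : (w : List ℕ) → Fin (length w) → ℕ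
#smallerLeft w i = length (filter (_<? lookup w i) (take (toℕ i) w))

#largerRight : (w : List ℕ) → Fin (length w) → ℕ
#largerRight w i = length (filter (lookup w i <?_) (drop (suc (toℕ i)) w))

{-# OPTIONS --safe #-}
-- Call x lagging if a larger entry stands to its left. The claim, by induction
-- on t, is that a lagging x whose left neighbour p in σ_t is smaller has at
-- least ⌈(t+1)/2⌉ smaller entries to its left. The set of these entries never
-- shrinks. In σ_{t-1}, either p directly followed x in the same decreasing
-- block, or p was the first entry of its block. In the first case x has just
-- gained p; moreover x was the first entry of its block in σ_{t-2}, hence
-- already had a smaller left neighbour there, and the claim applies to x at
-- time t-2. In the second case p, which is lagging too, had a smaller left
-- neighbour in σ_{t-1}, so the claim applies to p at time t-1, and x has p in
-- addition to what p has. The properties of Pop this uses are invariant under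
-- reversing both the word and the order of the values, which gives the half
-- about right-to-left minima.
module Submission where

open import Defs
open import Data.Fin.Base as Fin using (Fin; toℕ)
open import Data.Fin.Properties as Fin using (any?)
open import Data.List.Base using (List; []; _∷_; _++_; _∷ʳ_; length; lookup; take; drop; reverse; concatMap)
open import Data.List.Membership.Propositional using (_∈_)
open import Data.List.Membership.Propositional.Properties using (∈-++⁺ˡ; ∈-++⁺ʳ; ∈-++⁻; ∈-∃++; ∈-filter⁺; ∈-lookup)
open import Data.List.NonEmpty.Base using (List⁺; toList) renaming (_∷_ to _∷⁺_)
open import Data.List.Properties using (unfold-reverse; reverse-injective; ++-identityʳ)
open import Data.List.Relation.Binary.Permutation.Propositional using (↭-sym; ↭⇒↭ₛ)
open import Data.List.Relation.Binary.Permutation.Propositional.Properties using (∈-resp-↭; ↭-length; ↭-reverse; shift)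
open import Data.List.Relation.Binary.Permutation.Setoid.Properties using (Unique-resp-↭)
open import Data.List.Relation.Binary.Subset.Propositional using (_⊆_)
open import Data.List.Relation.Unary.All as All using (All; []; _∷_)
open import Data.List.Relation.Unary.AllPairs using (AllPairs; []; _∷_)
open import Data.List.Relation.Unary.Any using (here; there)
open import Data.List.Relation.Unary.Linked using (Linked; []; [-]; _∷_; tail)
open import Data.List.Relation.Unary.Unique.Propositional using (Unique)
open import Data.List.Relation.Unary.Unique.Propositional.Properties using (map⁺; upTo⁺)
open import Data.Nat.Base using (ℕ; zero; suc; _+_; _≤_; _<_; _>_; z≤n; s≤s; ⌈_/2⌉)
open import Data.Nat.Properties using (_<?_; ≤-refl; ≤-trans; ≤-reflexive; ≤-<-trans; <⇒≤; <-irrefl; <-trans; <-asym; ≮⇒≥; ≤∧≢⇒<; n≤1+n; +-comm; suc-injective; ⌈n/2⌉-mono; <-isStrictPartialOrder)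
open import Data.Product.Base using (_×_; _,_; ∃)
open import Data.Sum.Base using (_⊎_; inj₁; inj₂)
import Data.Sum.Base as Sum
open import Function.Base using (_∘_; flip)
open import Level using (0ℓ)
open import Relation.Binary.Construct.Flip.EqAndOrd using (isStrictPartialOrder)
open import Relation.Binary.Core using (Rel)
open import Relation.Binary.PropositionalEquality using (_≡_; refl; sym; cong; subst; setoid)
open import Relation.Binary.Structures using (IsStrictPartialOrder)
open import Relation.Nullary using (¬_; yes; no; contradiction)
open import Relation.Nullary.Decidable using (_×-dec_)
open import Relation.Unary using (Pred)

private
  variable
    A : Set
    P Q : Pred A 0ℓ
    k : ℕ
    u v w : List A
    a p x y z : A

-- Lower bounds on the number of elements with a property

-- Deleting one occurrence of `x` from `v` shortens it by one, and the rest of `u` still embeds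
-- because `x` does not recur there.
unique-⊆⇒length≤ : Unique u → u ⊆ v → length u ≤ length v
unique-⊆⇒length≤ [] _ = z≤n
unique-⊆⇒length≤ {u = x ∷ u} (x∉u ∷ u!) u⊆v with ∈-∃++ (u⊆v (here refl))
... | v₁ , v₂ , refl = ≤-trans (s≤s (unique-⊆⇒length≤ u! u⊆v₁v₂))
                               (≤-reflexive (sym (↭-length (shift x v₁ v₂))))
  where
  u⊆v₁v₂ : u ⊆ v₁ ++ v₂
  u⊆v₁v₂ y∈u with ∈-resp-↭ (shift x v₁ v₂) (u⊆v (there y∈u))
  ... | here y≡x = contradiction (sym y≡x) (All.lookup x∉u y∈u)
  ... | there y∈ = y∈

-- A list of witnesses instead of a cardinality: it can be carried from one word to the next and
-- extended by a new element.
AtLeast : ℕ → Pred A 0ℓ → Set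
AtLeast k P = ∃ λ u → Unique u × All P u × k ≤ length u

atLeast-mono : (∀ {x} → P x → Q x) → AtLeast k P → AtLeast k Q
atLeast-mono P⊆Q (u , u! , Pu , k≤) = u , u! , All.map P⊆Q Pu , k≤

atLeast-≤ : ∀ {j} → j ≤ k → AtLeast k P → AtLeast j P
atLeast-≤ j≤k (u , u! , Pu , k≤) = u , u! , Pu , ≤-trans j≤k k≤

atLeast-suc : (∀ {x} → P x → Q x) → Q y → ¬ P y → AtLeast k P → AtLeast (suc k) Q
atLeast-suc {P = P} {y = y} P⊆Q Qy ¬Py (u , u! , Pu , k≤) =
  y ∷ u , All.map (λ Px y≡x → ¬Py (subst P (sym y≡x) Px)) Pu ∷ u! , Qy ∷ All.map P⊆Q Pu , s≤s k≤

-- The lagging argument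

-- Holds vacuously when nothing stands before x.
SmallerLeftNeighbour : (_⊏_ before adjacent : Rel ℕ 0ℓ) → Pred ℕ 0ℓ
SmallerLeftNeighbour _⊏_ before adjacent x =
  ∀ {a} → before a x → ∃ λ z → adjacent z x × z ⊏ x

-- Obtained by flipping all three relations, so that passing to the dual process exchanges the two
-- notions definitionally.
LargerRightNeighbour : (_⊏_ before adjacent : Rel ℕ 0ℓ) → Pred ℕ 0ℓ
LargerRightNeighbour _⊏_ before adjacent =
  SmallerLeftNeighbour (flip _⊏_) (flip before) (flip adjacent)

-- Before t and Adjacent t compare positions at time t, and ⊏ compares values.
record PopProcess (_⊏_ : Rel ℕ 0ℓ) (Before Adjacent : ℕ → Rel ℕ 0ℓ) : Set where
  field
    ⊏-spo            : IsStrictPartialOrder _≡_ _⊏_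
    before-trans     : ∀ t {a b c} → Before t a b → Before t b c → Before t a c
    before-asym      : ∀ t {a b} → Before t a b → ¬ Before t b a
    adjacent⇒before  : ∀ t {a b} → Adjacent t a b → Before t a b
    before-adjacent  : ∀ t {a p x} → Adjacent t p x → Before t a x → a ≡ p ⊎ Before t a p
    adjacent-before  : ∀ t {a p x} → Adjacent t p x → Before t p a → a ≡ x ⊎ Before t x a
    ascents-persist  : ∀ t {x y} → x ⊏ y → Before t x y → Before (suc t) x y
    descents-persist : ∀ t {x y} → y ⊏ x → Before (suc t) x y → Before t x y
    -- Either `p` and `x` shared a decreasing block that got reversed, or `p` opened one block and
    -- `x` closed the next, where the two neighbour conditions describe block boundaries.
    adjacent-step    : ∀ t {p x} → Adjacent (suc t) p x →
                       (p ⊏ x × Adjacent t x p) ⊎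
                       (SmallerLeftNeighbour _⊏_ (Before t) (Adjacent t) p ×
                        LargerRightNeighbour _⊏_ (Before t) (Adjacent t) x)

dual : ∀ {_⊏_ Before Adjacent} → PopProcess _⊏_ Before Adjacent →
       PopProcess (flip _⊏_) (flip ∘ Before) (flip ∘ Adjacent)
dual S = record
  { ⊏-spo            = isStrictPartialOrder S.⊏-spo
  ; before-trans     = λ t ab bc → S.before-trans t bc ab
  ; before-asym      = λ t → S.before-asym t
  ; adjacent⇒before  = λ t → S.adjacent⇒before t
  ; before-adjacent  = λ t → S.adjacent-before t
  ; adjacent-before  = λ t → S.before-adjacent t
  ; ascents-persist  = λ t → S.ascents-persist t
  ; descents-persist = λ t → S.descents-persist t
  ; adjacent-step    = λ t xp → Sum.map₂ (λ (left , right) → right , left) (S.adjacent-step t xp)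
  }
  where module S = PopProcess S

module _ {_⊏_ Before Adjacent} (S : PopProcess _⊏_ Before Adjacent) where
  open PopProcess S
  open IsStrictPartialOrder ⊏-spo renaming (trans to ⊏-trans; irrefl to ⊏-irrefl; asym to ⊏-asym)

  SmallerBefore : ℕ → ℕ → Pred ℕ 0ℓ
  SmallerBefore t x a = a ⊏ x × Before t a x

  smallerBefore-persists : ∀ t {x a} → SmallerBefore t x a → SmallerBefore (suc t) x a
  smallerBefore-persists t (a⊏x , ax) = a⊏x , ascents-persist t a⊏x ax

  -- In all three bounds `y` witnesses that `x` is lagging. The bound for a descent is the weaker
  -- `⌈ t /2⌉`: it is inherited from time `t - 1`, and adding one to it gives exactly the bound for
  -- an ascent at time `t + 1`.
  ascent⇒atLeast : ∀ t {x y p} → x ⊏ y → Before t y x → Adjacent t p x → p ⊏ x →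
                   AtLeast ⌈ suc t /2⌉ (SmallerBefore t x)
  smallerLeftNeighbour⇒atLeast : ∀ t {x y} → x ⊏ y → Before t y x →
                   SmallerLeftNeighbour _⊏_ (Before t) (Adjacent t) x →
                   AtLeast ⌈ suc t /2⌉ (SmallerBefore (suc t) x)
  descent⇒atLeast : ∀ t {x y q} → x ⊏ y → Before t y x → Adjacent t x q → q ⊏ x →
                    AtLeast ⌈ t /2⌉ (SmallerBefore t x)

  ascent⇒atLeast zero _ _ px p⊏x =
    _ ∷ [] , [] ∷ [] , (p⊏x , adjacent⇒before zero px) ∷ [] , ≤-refl
  ascent⇒atLeast (suc t) x⊏y yx px p⊏x with adjacent-step t px
  ... | inj₁ (_ , xp) =
    -- The new element is `p`, which still stood to the right of `x` at time `t`.
    atLeast-suc (smallerBefore-persists t) (p⊏x , adjacent⇒before (suc t) px)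
      (λ (_ , px′) → before-asym t px′ (adjacent⇒before t xp))
      (descent⇒atLeast t x⊏y (descents-persist t x⊏y yx) xp p⊏x)
  ... | inj₂ (left , _) with before-adjacent (suc t) px yx
  -- From `p ⊏ x ⊏ y` it follows that `y` is not `p`, so `y` lies further left and `p` is lagging as
  -- well.
  ...   | inj₁ refl = contradiction p⊏x (⊏-asym x⊏y)
  ...   | inj₂ yp   =
    atLeast-suc
      (λ (a⊏p , ap) → ⊏-trans a⊏p p⊏x , before-trans (suc t) ap (adjacent⇒before (suc t) px))
      (p⊏x , adjacent⇒before (suc t) px) (λ (p⊏p , _) → ⊏-irrefl refl p⊏p)
      -- One step back already yields `⌈ suc t /2⌉` for `p`; only `⌈ t /2⌉` is required, since
      -- counting `p` itself supplies the remaining one.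
      (atLeast-≤ (⌈n/2⌉-mono (n≤1+n t))
        (smallerLeftNeighbour⇒atLeast t p⊏y (descents-persist t p⊏y yp) left))
    where p⊏y = ⊏-trans p⊏x x⊏y

  smallerLeftNeighbour⇒atLeast t x⊏y yx left =
    let (_ , zx , z⊏x) = left yx
    in atLeast-mono (smallerBefore-persists t) (ascent⇒atLeast t x⊏y yx zx z⊏x)

  descent⇒atLeast zero    _   _  _  _   = [] , [] , [] , z≤n
  descent⇒atLeast (suc t) x⊏y yx xq q⊏x with adjacent-step t xq
  -- Two neighbours coming from one reversed block ascend, so at a descent `x` must have opened its
  -- block one step earlier.
  ... | inj₁ (x⊏q , _)  = contradiction q⊏x (⊏-asym x⊏q)
  ... | inj₂ (left , _) = smallerLeftNeighbour⇒atLeast t x⊏y (descents-persist t x⊏y yx) left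

-- Relative positions in a word

-- Entries are identified by value, which survives `pop`, rather than by position. With distinct
-- entries this relation is a strict order.
data Before {A : Set} : List A → A → A → Set where
  here  : y ∈ w → Before (x ∷ w) x y
  there : Before w x y → Before (z ∷ w) x y

data Adjacent {A : Set} : List A → A → A → Set where
  here  : Adjacent (x ∷ y ∷ w) x y
  there : Adjacent w x y → Adjacent (z ∷ w) x y

data First {A : Set} : List A → A → Set where
  first : First (x ∷ w) x

data Last {A : Set} : List A → A → Set where
  here  : Last (x ∷ []) x
  there : Last w x → Last (y ∷ w) x

before⇒∈ˡ : Before w x y → x ∈ w
before⇒∈ˡ (here _)   = here refl
before⇒∈ˡ (there xy) = there (before⇒∈ˡ xy)

before⇒∈ʳ : Before w x y → y ∈ w
before⇒∈ʳ (here y∈w) = there y∈w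
before⇒∈ʳ (there xy) = there (before⇒∈ʳ xy)

Adjacent⇒Before : Adjacent w x y → Before w x y
Adjacent⇒Before here       = here (here refl)
Adjacent⇒Before (there xy) = there (Adjacent⇒Before xy)

Before-total : x ∈ w → y ∈ w → x ≡ y ⊎ Before w x y ⊎ Before w y x
Before-total (here refl) (here refl) = inj₁ refl
Before-total (here refl) (there y∈)  = inj₂ (inj₁ (here y∈))
Before-total (there x∈)  (here refl) = inj₂ (inj₂ (here x∈))
Before-total (there x∈)  (there y∈)  = Sum.map₂ (Sum.map there there) (Before-total x∈ y∈)

AllPairs-before : ∀ {R : Rel A 0ℓ} → AllPairs R w → Before w x y → R x y
AllPairs-before (Rx ∷ _)  (here y∈)  = All.lookup Rx y∈
AllPairs-before (_  ∷ Rw) (there xy) = AllPairs-before Rw xy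

Before-asym : Unique w → Before w x y → ¬ Before w y x
Before-asym (x∉ ∷ _) (here _)   (here x∈)  = All.lookup x∉ x∈ refl
Before-asym (x∉ ∷ _) (here _)   (there yx) = All.lookup x∉ (before⇒∈ʳ yx) refl
Before-asym (y∉ ∷ _) (there xy) (here _)   = All.lookup y∉ (before⇒∈ʳ xy) refl
Before-asym (_ ∷ w!) (there xy) (there yx) = Before-asym w! xy yx

Before-trans : Unique w → Before w x y → Before w y z → Before w x z
Before-trans (x∉ ∷ _) (here y∈)  (here _)   = contradiction refl (All.lookup x∉ y∈)
Before-trans _        (here _)   (there yz) = here (before⇒∈ʳ yz)
Before-trans (y∉ ∷ _) (there xy) (here _)   = contradiction refl (All.lookup y∉ (before⇒∈ʳ xy))
Before-trans (_ ∷ w!) (there xy) (there yz) = there (Before-trans w! xy yz)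

Before-Adjacent : Unique w → Adjacent w p x → Before w a x → a ≡ p ⊎ Before w a p
Before-Adjacent _              here       (here _)          = inj₁ refl
Before-Adjacent (_ ∷ (x∉ ∷ _)) here       (there (here x∈)) = contradiction refl (All.lookup x∉ x∈)
Before-Adjacent (_ ∷ (x∉ ∷ _)) here       (there (there ax)) = contradiction refl (All.lookup x∉ (before⇒∈ʳ ax))
Before-Adjacent _              (there px) (here _)          = inj₂ (here (before⇒∈ˡ (Adjacent⇒Before px)))
Before-Adjacent (_ ∷ w!)       (there px) (there ax)        = Sum.map₂ there (Before-Adjacent w! px ax)

Adjacent-Before : Unique w → Adjacent w p x → Before w p a → a ≡ x ⊎ Before w x a
Adjacent-Before _        here       (here (here a≡x)) = inj₁ a≡x
Adjacent-Before _        here       (here (there a∈)) = inj₂ (there (here a∈))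
Adjacent-Before (p∉ ∷ _) here       (there pa)        = contradiction refl (All.lookup p∉ (before⇒∈ˡ pa))
Adjacent-Before (p∉ ∷ _) (there px) (here _)          = contradiction refl (All.lookup p∉ (before⇒∈ˡ (Adjacent⇒Before px)))
Adjacent-Before (_ ∷ w!) (there px) (there pa)        = Sum.map₂ there (Adjacent-Before w! px pa)

first-minimal : Unique w → First w x → ¬ Before w a x
first-minimal (x∉ ∷ _) first (here x∈)  = All.lookup x∉ x∈ refl
first-minimal (x∉ ∷ _) first (there ax) = All.lookup x∉ (before⇒∈ʳ ax) refl

last⇒∈ : Last w x → x ∈ w
last⇒∈ here      = here refl
last⇒∈ (there l) = there (last⇒∈ l)

last-maximal : Unique w → Last w x → ¬ Before w x a
last-maximal (x∉ ∷ _) (there l) (here _)   = All.lookup x∉ (last⇒∈ l) refl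
last-maximal (_ ∷ w!) (there l) (there xa) = last-maximal w! l xa

∷-last : ∀ (x : A) u → ∃ (Last (x ∷ u))
∷-last x []      = x , here
∷-last x (y ∷ u) = let (l , last) = ∷-last y u in l , there last

before-++⁻ : ∀ u → Before (u ++ v) x y → Before u x y ⊎ (x ∈ u × y ∈ v) ⊎ Before v x y
before-++⁻ []      xy        = inj₂ (inj₂ xy)
before-++⁻ (_ ∷ u) (here y∈) with ∈-++⁻ u y∈
... | inj₁ y∈u = inj₁ (here y∈u)
... | inj₂ y∈v = inj₂ (inj₁ (here refl , y∈v))
before-++⁻ (_ ∷ u) (there xy) = Sum.map there (Sum.map₁ (λ (x∈ , y∈) → there x∈ , y∈)) (before-++⁻ u xy)

before-++⁺ˡ : Before u x y → Before (u ++ v) x y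
before-++⁺ˡ (here y∈)  = here (∈-++⁺ˡ y∈)
before-++⁺ˡ (there xy) = there (before-++⁺ˡ xy)

before-++⁺ʳ : ∀ u → Before v x y → Before (u ++ v) x y
before-++⁺ʳ []      xy = xy
before-++⁺ʳ (_ ∷ u) xy = there (before-++⁺ʳ u xy)

before-++⁺ : x ∈ u → y ∈ v → Before (u ++ v) x y
before-++⁺ {u = _ ∷ u} (here refl) y∈ = here (∈-++⁺ʳ u y∈)
before-++⁺             (there x∈)  y∈ = there (before-++⁺ x∈ y∈)

adjacent-++⁻ : ∀ u → Adjacent (u ++ v) x y → Adjacent u x y ⊎ (Last u x × First v y) ⊎ Adjacent v x y
adjacent-++⁻ []          xy         = inj₂ (inj₂ xy)
adjacent-++⁻ (_ ∷ [])    here       = inj₂ (inj₁ (here , first))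
adjacent-++⁻ (_ ∷ _ ∷ _) here       = inj₁ here
adjacent-++⁻ (_ ∷ u)     (there xy) = Sum.map there (Sum.map₁ (λ (l , f) → there l , f)) (adjacent-++⁻ u xy)

adjacent-++⁺ˡ : Adjacent u x y → Adjacent (u ++ v) x y
adjacent-++⁺ˡ here       = here
adjacent-++⁺ˡ (there xy) = there (adjacent-++⁺ˡ xy)

adjacent-++⁺ʳ : ∀ u → Adjacent v x y → Adjacent (u ++ v) x y
adjacent-++⁺ʳ []      xy = xy
adjacent-++⁺ʳ (_ ∷ u) xy = there (adjacent-++⁺ʳ u xy)

adjacent-++⁺ : Last u x → First v y → Adjacent (u ++ v) x y
adjacent-++⁺ here      first = here
adjacent-++⁺ (there l) f     = there (adjacent-++⁺ l f)

first-++⁺ : First u x → First (u ++ v) x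
first-++⁺ first = first

last-++⁺ : ∀ u → Last v x → Last (u ++ v) x
last-++⁺ []      l = l
last-++⁺ (_ ∷ u) l = there (last-++⁺ u l)

last-∷ʳ⁻ : ∀ u → Last (u ∷ʳ x) y → y ≡ x
last-∷ʳ⁻ []          here      = refl
last-∷ʳ⁻ (_ ∷ [])    (there l) = last-∷ʳ⁻ [] l
last-∷ʳ⁻ (_ ∷ _ ∷ u) (there l) = last-∷ʳ⁻ (_ ∷ u) l

last-reverse⁻ : ∀ u → Last (reverse u) x → First u x
last-reverse⁻ (y ∷ u) l rewrite unfold-reverse y u with last-∷ʳ⁻ (reverse u) l
... | refl = first

first-∷ʳ⁻ : ∀ u → First (u ∷ʳ x) y → First u y ⊎ (u ≡ [] × y ≡ x)
first-∷ʳ⁻ []      first = inj₂ (refl , refl)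
first-∷ʳ⁻ (_ ∷ _) first = inj₁ first

first-reverse⁻ : ∀ u → First (reverse u) x → Last u x
first-reverse⁻ (y ∷ u) f rewrite unfold-reverse y u with first-∷ʳ⁻ (reverse u) f
... | inj₁ f′ = there (first-reverse⁻ u f′)
... | inj₂ (e , refl) with reverse-injective {x = u} {y = []} e
...   | refl = here

adjacent-reverse⁻ : ∀ u → Adjacent (reverse u) x y → Adjacent u y x
adjacent-reverse⁻ (z ∷ u) xy rewrite unfold-reverse z u with adjacent-++⁻ (reverse u) xy
... | inj₁ xy′ = there (adjacent-reverse⁻ u xy′)
... | inj₂ (inj₁ (l , first)) with last-reverse⁻ u l
...   | first = here
adjacent-reverse⁻ (z ∷ u) xy | inj₂ (inj₂ (there ()))

∈-reverse⁺ : x ∈ u → x ∈ reverse u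
∈-reverse⁺ {u = u} = ∈-resp-↭ (↭-sym (↭-reverse u))

before-reverse⁺ : ∀ u → Before u x y → Before (reverse u) y x
before-reverse⁺ (z ∷ u) (here y∈) rewrite unfold-reverse z u = before-++⁺ (∈-reverse⁺ y∈) (here refl)
before-reverse⁺ (z ∷ u) (there xy) rewrite unfold-reverse z u = before-++⁺ˡ (before-reverse⁺ u xy)

-- Decreasing blocks

Decreasing : List⁺ ℕ → Set
Decreasing b = AllPairs _>_ (toList b)

-- Encodes maximality of the blocks. The inequality is weak because `attach` starts a new block
-- whenever `y < x` fails; distinctness makes it strict later.
_⊑_ : Rel (List⁺ ℕ) 0ℓ
b ⊑ c = ∀ {l f} → Last (toList b) l → First (toList c) f → l ≤ f

attach-decreasing : ∀ x {bs} → All Decreasing bs → All Decreasing (attach x bs)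
attach-decreasing x [] = ([] ∷ []) ∷ []
attach-decreasing x {(y ∷⁺ ys) ∷ bs} ((y>ys ∷ ys↓) ∷ bs↓) with y <? x
... | yes y<x = ((y<x ∷ All.map (λ z<y → <-trans z<y y<x) y>ys) ∷ (y>ys ∷ ys↓)) ∷ bs↓
... | no  _   = ([] ∷ []) ∷ (y>ys ∷ ys↓) ∷ bs↓

-- A new singleton block is linked by the failed comparison, and extending a block at its front
-- leaves its last entry unchanged.
attach-linked : ∀ x {bs} → Linked _⊑_ bs → Linked _⊑_ (attach x bs)
attach-linked x {[]} _ = [-]
attach-linked x {(y ∷⁺ ys) ∷ bs} bs⊑ with y <? x
... | no  y≮x = (λ { here first → ≮⇒≥ y≮x }) ∷ bs⊑
attach-linked x {(y ∷⁺ ys) ∷ []}    _          | yes _ = [-]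
attach-linked x {(y ∷⁺ ys) ∷ _ ∷ _} (b⊑ ∷ bs⊑) | yes _ = (λ { (there l) f → b⊑ l f }) ∷ bs⊑

decreasingBlocks-decreasing : ∀ w → All Decreasing (decreasingBlocks w)
decreasingBlocks-decreasing []      = []
decreasingBlocks-decreasing (x ∷ w) = attach-decreasing x (decreasingBlocks-decreasing w)

decreasingBlocks-linked : ∀ w → Linked _⊑_ (decreasingBlocks w)
decreasingBlocks-linked []      = []
decreasingBlocks-linked (x ∷ w) = attach-linked x (decreasingBlocks-linked w)

∈-reverseBlocks : ∀ bs → x ∈ concatMap toList bs → x ∈ reverseBlocks bs
∈-reverseBlocks bs = ∈-resp-↭ (↭-sym (reverseBlocks-↭ bs))

-- An ascending pair cannot lie in one decreasing block, and entries of different blocks keep their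
-- order.
reverseBlocks-ascents-persist : ∀ {bs} → All Decreasing bs → x < y →
  Before (concatMap toList bs) x y → Before (reverseBlocks bs) x y
reverseBlocks-ascents-persist {bs = b ∷ bs} (b↓ ∷ bs↓) x<y xy with before-++⁻ (toList b) xy
... | inj₁ xy′              = contradiction (AllPairs-before b↓ xy′) (<-asym x<y)
... | inj₂ (inj₁ (x∈ , y∈)) = before-++⁺ (∈-reverse⁺ x∈) (∈-reverseBlocks bs y∈)
... | inj₂ (inj₂ xy′)       = before-++⁺ʳ (reverse (toList b)) (reverseBlocks-ascents-persist bs↓ x<y xy′)

-- Block boundaries are expressed through neighbours in the word itself, without reference to its
-- decomposition.
BlockStart : List ℕ → ℕ → Set
BlockStart w p = First w p ⊎ ∃ λ z → Adjacent w z p × z ≤ p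

BlockEnd : List ℕ → ℕ → Set
BlockEnd w x = Last w x ⊎ ∃ λ z → Adjacent w x z × x ≤ z

-- An entry that opened the shorter word acquires the last entry of `b` as left neighbour, and `⊑`
-- compares the two.
blockStart-∷ : ∀ {b bs} → Linked _⊑_ (b ∷ bs) →
  BlockStart (concatMap toList bs) p → BlockStart (concatMap toList (b ∷ bs)) p
blockStart-∷ {b = y ∷⁺ ys} {bs = _ ∷ _} (b⊑ ∷ _) (inj₁ first) =
  let (l , last) = ∷-last y ys in inj₂ (l , adjacent-++⁺ last first , b⊑ last first)
blockStart-∷ {b = b} _ (inj₂ (z , zp , z≤p)) = inj₂ (z , adjacent-++⁺ʳ (toList b) zp , z≤p)

blockEnd-∷ : ∀ b {v} → BlockEnd v x → BlockEnd (toList b ++ v) x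
blockEnd-∷ b (inj₁ last)           = inj₁ (last-++⁺ (toList b) last)
blockEnd-∷ b (inj₂ (z , xz , x≤z)) = inj₂ (z , adjacent-++⁺ʳ (toList b) xz , x≤z)

last⇒blockEnd : ∀ {b bs} → Linked _⊑_ (b ∷ bs) → Last (toList b) x →
  BlockEnd (concatMap toList (b ∷ bs)) x
last⇒blockEnd {x} {b} [-] last = inj₁ (subst (λ u → Last u x) (sym (++-identityʳ (toList b))) last)
last⇒blockEnd (b⊑ ∷ _) last = inj₂ (_ , adjacent-++⁺ last first , b⊑ last first)

-- Blocks are nonempty, so the first entry comes from the reversal of `c`.
first-reverseBlocks : ∀ c bs → First (reverseBlocks (c ∷ bs)) x → Last (toList c) x
first-reverseBlocks c bs f with reverse (toList c) in eq
... | _ ∷ _ with first ← f = first-reverse⁻ (toList c) (subst (λ u → First u _) (sym eq) first)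
first-reverseBlocks (y ∷⁺ ys) bs f | [] with () ← reverse-injective {x = y ∷ ys} {y = []} eq

-- The pair lies inside the reversed `b`, across its right end, or in the rest. Across the end, `p`
-- closes the reversed `b` and hence opened `b`, while `x` opens the reversal of the next block and
-- hence closed that block.
adjacent-reverseBlocks : ∀ {bs} → All Decreasing bs → Linked _⊑_ bs →
  Adjacent (reverseBlocks bs) p x →
  (p < x × Adjacent (concatMap toList bs) x p) ⊎
  (BlockStart (concatMap toList bs) p × BlockEnd (concatMap toList bs) x)
adjacent-reverseBlocks {bs = b ∷ bs} (b↓ ∷ bs↓) bs⊑ px with adjacent-++⁻ (reverse (toList b)) px
... | inj₁ px′ =
  let xp = adjacent-reverse⁻ (toList b) px′
  in inj₁ (AllPairs-before b↓ (Adjacent⇒Before xp) , adjacent-++⁺ˡ xp)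
adjacent-reverseBlocks {bs = b ∷ c ∷ bs} _ (_ ∷ bs⊑) px | inj₂ (inj₁ (last , f)) =
  inj₂ (inj₁ (first-++⁺ (last-reverse⁻ (toList b) last)) ,
        blockEnd-∷ b (last⇒blockEnd bs⊑ (first-reverseBlocks c bs f)))
adjacent-reverseBlocks {bs = b ∷ bs} (_ ∷ bs↓) b∷bs⊑ px | inj₂ (inj₂ px′)
  with adjacent-reverseBlocks bs↓ (tail b∷bs⊑) px′
... | inj₁ (p<x , xp)    = inj₁ (p<x , adjacent-++⁺ʳ (toList b) xp)
... | inj₂ (start , end) = inj₂ (blockStart-∷ b∷bs⊑ start , blockEnd-∷ b end)

-- The effect of one `pop` on relative positions

pop-ascents-persist : ∀ w → x < y → Before w x y → Before (pop w) x y
pop-ascents-persist w x<y xy = reverseBlocks-ascents-persist (decreasingBlocks-decreasing w) x<y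
  (subst (λ u → Before u _ _) (sym (concat-decreasingBlocks w)) xy)

-- Contrapositive of the persistence of ascents: had `y` stood before `x`, it would still do so.
pop-descents-persist : Unique (pop w) → y < x → Before (pop w) x y → Before w x y
pop-descents-persist {w = w} pop! y<x xy
  with Before-total (∈-resp-↭ (pop-↭ w) (before⇒∈ˡ xy)) (∈-resp-↭ (pop-↭ w) (before⇒∈ʳ xy))
... | inj₁ refl       = contradiction y<x (<-irrefl refl)
... | inj₂ (inj₁ xy′) = xy′
... | inj₂ (inj₂ yx)  = contradiction (pop-ascents-persist w y<x yx) (Before-asym pop! xy)

adjacent-≤⇒< : Unique w → Adjacent w x y → x ≤ y → x < y
adjacent-≤⇒< w! xy x≤y = ≤∧≢⇒< x≤y (AllPairs-before w! (Adjacent⇒Before xy))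

blockStart⇒smallerLeftNeighbour : Unique w → BlockStart w p →
  SmallerLeftNeighbour _<_ (Before w) (Adjacent w) p
blockStart⇒smallerLeftNeighbour w! (inj₁ first) ap = contradiction ap (first-minimal w! first)
blockStart⇒smallerLeftNeighbour w! (inj₂ (z , zp , z≤p)) _ = z , zp , adjacent-≤⇒< w! zp z≤p

blockEnd⇒largerRightNeighbour : Unique w → BlockEnd w x →
  LargerRightNeighbour _<_ (Before w) (Adjacent w) x
blockEnd⇒largerRightNeighbour w! (inj₁ last) xa = contradiction xa (last-maximal w! last)
blockEnd⇒largerRightNeighbour w! (inj₂ (z , xz , x≤z)) _ = z , xz , adjacent-≤⇒< w! xz x≤z

pop-adjacent : Unique w → Adjacent (pop w) p x →
  (p < x × Adjacent w x p) ⊎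
  (SmallerLeftNeighbour _<_ (Before w) (Adjacent w) p × LargerRightNeighbour _<_ (Before w) (Adjacent w) x)
pop-adjacent {w = w} w! px
  with adjacent-reverseBlocks (decreasingBlocks-decreasing w) (decreasingBlocks-linked w) px
... | r rewrite concat-decreasingBlocks w =
  Sum.map₂ (λ (start , end) → blockStart⇒smallerLeftNeighbour w! start ,
                              blockEnd⇒largerRightNeighbour w! end) r

-- The iterates of a permutation as a `PopProcess`

perm-unique : ∀ {n} (σ : Perm n) → Unique (entries σ)
perm-unique {n} (mkPerm w w↭) =
  Unique-resp-↭ (setoid ℕ) (↭⇒↭ₛ (↭-sym w↭)) (map⁺ suc-injective (upTo⁺ n))

module _ {n} (σ : Perm n) where

  σ[_] : ℕ → List ℕ
  σ[ t ] = entries (Pop^ t σ)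

  unique : ∀ t → Unique σ[ t ]
  unique t = perm-unique (Pop^ t σ)

  popProcess : PopProcess _<_ (λ t → Before σ[ t ]) (λ t → Adjacent σ[ t ])
  popProcess = record
    { ⊏-spo            = <-isStrictPartialOrder
    ; before-trans     = λ t → Before-trans (unique t)
    ; before-asym      = λ t → Before-asym (unique t)
    ; adjacent⇒before  = λ t → Adjacent⇒Before
    ; before-adjacent  = λ t → Before-Adjacent (unique t)
    ; adjacent-before  = λ t → Adjacent-Before (unique t)
    ; ascents-persist  = λ t → pop-ascents-persist σ[ t ]
    ; descents-persist = λ t → pop-descents-persist (unique (suc t))
    ; adjacent-step    = λ t → pop-adjacent (unique t)
    }

-- Entries of a word at given positions

lookup-before : ∀ (w : List A) {i j} → i Fin.< j → Before w (lookup w i) (lookup w j)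
lookup-before (x ∷ w) {Fin.zero}  {Fin.suc j} _         = here (∈-lookup j)
lookup-before (x ∷ w) {Fin.suc i} {Fin.suc j} (s≤s i<j) = there (lookup-before w i<j)

lookup-adjacent : ∀ (w : List A) {i j} → suc (toℕ i) ≡ toℕ j → Adjacent w (lookup w i) (lookup w j)
lookup-adjacent (x ∷ y ∷ w) {Fin.zero}  {Fin.suc Fin.zero} _ = here
lookup-adjacent (x ∷ w)     {Fin.suc i} {Fin.suc j}        e = there (lookup-adjacent w (suc-injective e))

before-lookup⇒∈take : Unique w → ∀ i → Before w x (lookup w i) → x ∈ take (toℕ i) w
before-lookup⇒∈take (y∉ ∷ _) Fin.zero    (here y∈)  = contradiction refl (All.lookup y∉ y∈)
before-lookup⇒∈take (y∉ ∷ _) Fin.zero    (there xy) = contradiction refl (All.lookup y∉ (before⇒∈ʳ xy))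
before-lookup⇒∈take {w = _ ∷ _} _        (Fin.suc i) (here _)   = here refl
before-lookup⇒∈take (_ ∷ w!) (Fin.suc i) (there xy) = there (before-lookup⇒∈take w! i xy)

lookup-before⇒∈drop : Unique w → ∀ i → Before w (lookup w i) x → x ∈ drop (suc (toℕ i)) w
lookup-before⇒∈drop {w = _ ∷ _} _        Fin.zero    (here x∈)  = x∈
lookup-before⇒∈drop {w = _ ∷ _} _        Fin.zero    (there yx) = before⇒∈ʳ yx
lookup-before⇒∈drop (y∉ ∷ _) (Fin.suc i) (here _)   = contradiction refl (All.lookup y∉ (∈-lookup i))
lookup-before⇒∈drop (_ ∷ w!) (Fin.suc i) (there yx) = lookup-before⇒∈drop w! i yx

-- The distinct witnesses all occur in the filtered prefix, which is therefore at least as long as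
-- their list.
atLeast-#smallerLeft : Unique w → ∀ i →
  AtLeast k (λ a → a < lookup w i × Before w a (lookup w i)) → k ≤ #smallerLeft w i
atLeast-#smallerLeft {w = w} w! i (u , u! , all , k≤) = ≤-trans k≤ (unique-⊆⇒length≤ u! λ a∈u →
  let (a<x , ax) = All.lookup all a∈u
  in ∈-filter⁺ (_<? lookup w i) (before-lookup⇒∈take w! i ax) a<x)

atLeast-#largerRight : Unique w → ∀ i →
  AtLeast k (λ a → lookup w i < a × Before w (lookup w i) a) → k ≤ #largerRight w i
atLeast-#largerRight {w = w} w! i (u , u! , all , k≤) = ≤-trans k≤ (unique-⊆⇒length≤ u! λ a∈u →
  let (x<a , xa) = All.lookup all a∈u
  in ∈-filter⁺ (lookup w i <?_) (lookup-before⇒∈drop w! i xa) x<a)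

-- A finite search either finds the witness `y` of lagging or fails, in which case distinctness
-- makes the resulting inequalities strict.
leftToRightMax? : Unique w → ∀ i →
  LeftToRightMax w i ⊎ ∃ λ y → lookup w i < y × Before w y (lookup w i)
leftToRightMax? {w = w} w! i with any? (λ j → (j Fin.<? i) ×-dec (lookup w i <? lookup w j))
... | yes (j , j<i , x<y) = inj₂ (lookup w j , x<y , lookup-before w j<i)
... | no  ∄j = inj₁ λ j j<i →
  ≤∧≢⇒< (≮⇒≥ λ x<y → ∄j (j , j<i , x<y)) (AllPairs-before w! (lookup-before w j<i))

rightToLeftMin? : Unique w → ∀ i →
  RightToLeftMin w i ⊎ ∃ λ y → y < lookup w i × Before w (lookup w i) y
rightToLeftMin? {w = w} w! i with any? (λ j → (i Fin.<? j) ×-dec (lookup w j <? lookup w i))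
... | yes (j , i<j , y<x) = inj₂ (lookup w j , y<x , lookup-before w i<j)
... | no  ∄j = inj₁ λ j i<j →
  ≤∧≢⇒< (≮⇒≥ λ y<x → ∄j (j , i<j , y<x)) (AllPairs-before w! (lookup-before w i<j))

<⇒predecessor : ∀ {n} {a i : Fin n} → a Fin.< i → ∃ λ (j : Fin n) → a Fin.≤ j × suc (toℕ j) ≡ toℕ i
<⇒predecessor {i = Fin.suc i} (s≤s a≤i) =
  Fin.inject₁ i , subst (_ ≤_) (sym (Fin.toℕ-inject₁ i)) a≤i , cong suc (Fin.toℕ-inject₁ i)

<⇒successor : ∀ {n} {i b : Fin n} → i Fin.< b → ∃ λ (j : Fin n) → j Fin.≤ b × suc (toℕ i) ≡ toℕ j
<⇒successor {n} {i} {b} i<b = Fin.fromℕ< 1+i<n , subst (_≤ toℕ b) (sym 1+i≡) i<b , sym 1+i≡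
  where
  1+i<n : suc (toℕ i) < n
  1+i<n = ≤-<-trans i<b (Fin.toℕ<n b)
  1+i≡ : toℕ (Fin.fromℕ< 1+i<n) ≡ suc (toℕ i)
  1+i≡ = Fin.toℕ-fromℕ< 1+i<n

-- As `a < i < b` strictly, both neighbours of position `i` still lie in the run.
interior⇒neighbours : ∀ w {i} → InteriorOfIncreasingRun w i →
  (∃ λ p → Adjacent w p (lookup w i) × p < lookup w i) ×
  (∃ λ q → Adjacent w (lookup w i) q × lookup w i < q)
interior⇒neighbours w {i} (a , b , run , a<i , i<b) =
  let (p , a≤p , p≡) = <⇒predecessor a<i
      (q , q≤b , q≡) = <⇒successor i<b
  in (lookup w p , lookup-adjacent w p≡ , increasing p i a≤p (≤-reflexive p≡) (<⇒≤ i<b)) ,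
     (lookup w q , lookup-adjacent w q≡ , increasing i q (<⇒≤ a<i) (≤-reflexive q≡) q≤b)
  where open IncreasingRun run

lemma5 : ∀ (n : ℕ) (σ : Perm n) (t : ℕ) →
    let σₜ = entries (Pop^ t σ) in
    (i : Fin (length σₜ)) → InteriorOfIncreasingRun σₜ i →
    (LeftToRightMax σₜ i ⊎ ⌈ t + 1 /2⌉ ≤ #smallerLeft σₜ i) ×
    (RightToLeftMin σₜ i ⊎ ⌈ t + 1 /2⌉ ≤ #largerRight σₜ i)
lemma5 n σ t i interior rewrite +-comm t 1 =
  let ((p , px , p<x) , (q , xq , x<q)) = interior⇒neighbours (entries (Pop^ t σ)) interior
      w! = unique σ t
  in Sum.map₂ (λ (y , x<y , yx) → atLeast-#smallerLeft w! i
       (ascent⇒atLeast (popProcess σ) t x<y yx px p<x)) (leftToRightMax? w! i) ,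
     -- In the dual process the right neighbour `q` is the smaller left neighbour of the entry, and
     -- `y` is again the witness of lagging.
     Sum.map₂ (λ (y , y<x , xy) → atLeast-#largerRight w! i
       (ascent⇒atLeast (dual (popProcess σ)) t y<x xy xq x<q)) (rightToLeftMin? w! i)
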